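{- Let $\mathbf A$ be a square matrix of size $n$ with entries in $\{0,L,A,M\}$, and let $\mathbf B=\bigcup_{i}\mathbf A^i$ be its union closure (union over all $i\ge0$). Then $\mathbf B=\bigcup_{i<n^2}\mathbf A^i$; that is, the union closure can be calculated by considering just the first $n^2$ matrix powers.
   Context: The set $\{0,L,A,M\}$ is ordered by $0<L<A<M$. Union $\cup$ is the maximum. Sum: $0$ is neutral, $L+L=A$, and otherwise $x+y=\max(x,y)$. Product: $0\times x=x\times0=0$, $L\times x=x\times L=x$, and $x\times y=\max(x,y)$ for $x,y\in\{A,M\}$. Matrix product is $(\mathbf A\times\mathbf B)_{i,j}=\sum_k\mathbf A_{i,k}\times\mathbf B_{k,j}$ with these operations, union of matrices is entrywise, and $\mathbf A^0=\mathbf I$ is the matrix with $L$ on the diagonal and $0$ elsewhere.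
   Formalization: The sizes n = 1 and n = 2 are excluded, because the claim fails there: for n = 1 take A = (M); for n = 2 take A with rows (0, L) and (L, L), where the fourth power is needed. The bound i < n² is proved for n = 0 and all n ≥ 3. -}

module Defs where

open import Data.Bool using (if_then_else_)
open import Data.Fin using (Fin; zero; suc)
open import Data.Fin.Properties using (_≟_)
import Data.Nat as ℕ
open import Data.Nat using (ℕ; zero; suc; s≤s)
open import Data.Product using (_×_; _,_)
open import Data.Vec.Functional using (Vector; foldr)
open import Function using (_on_)
open import Relation.Binary.PropositionalEquality using (_≡_)
open import Relation.Nullary using (¬_; does)

data Value : Set where
  𝟎 L A M : Value

rank : Value → ℕ
rank 𝟎 = 0
rank L = 1
rank A = 2
rank M = 3

infix  4 _≤_
infixl 6 _∪_ _+_
infixl 7 _·_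

_≤_ : Value → Value → Set
_≤_ = ℕ._≤_ on rank

_∪_ : Value → Value → Value
𝟎 ∪ y = y
L ∪ 𝟎 = L
L ∪ y = y
A ∪ M = M
A ∪ _ = A
M ∪ _ = M

_+_ : Value → Value → Value
𝟎 + y = y
x + 𝟎 = x
L + L = A
x + y = x ∪ y

_·_ : Value → Value → Value
𝟎 · _ = 𝟎
_ · 𝟎 = 𝟎
L · y = y
x · L = x
x · y = x ∪ y

∑ : ∀ {n} → Vector Value n → Value
∑ = foldr _+_ 𝟎

Matrix : ℕ → Set
Matrix n = Fin n → Fin n → Value

infix  4 _≐_
infixl 6 _⊔_
infixl 7 _⊗_
infixr 8 _^_

_≐_ : ∀ {n} → Matrix n → Matrix n → Set
𝐀 ≐ 𝐁 = ∀ i j → 𝐀 i j ≡ 𝐁 i j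

𝐈 : ∀ {n} → Matrix n
𝐈 i j = if does (i ≟ j) then L else 𝟎

_⊗_ : ∀ {n} → Matrix n → Matrix n → Matrix n
(𝐀 ⊗ 𝐁) i j = ∑ (λ k → 𝐀 i k · 𝐁 k j)

_^_ : ∀ {n} → Matrix n → ℕ → Matrix n
𝐀 ^ zero  = 𝐈
𝐀 ^ suc m = 𝐀 ⊗ 𝐀 ^ m

_⊔_ : ∀ {n} → Matrix n → Matrix n → Matrix n
(𝐀 ⊔ 𝐁) i j = 𝐀 i j ∪ 𝐁 i j

-- ⋃[i< m ] 𝐀 is the union of 𝐀 ^ i over all i < m; the empty union is the
-- zero matrix, since 𝟎 is the least value.
⋃[i<_] : ∀ {n} → ℕ → Matrix n → Matrix n
⋃[i< zero  ] 𝐀 = λ _ _ → 𝟎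
⋃[i< suc m ] 𝐀 = ⋃[i< m ] 𝐀 ⊔ 𝐀 ^ m

IsSupremum : {I : Set} → (I → Value) → Value → Set
IsSupremum f s = (∀ i → f i ≤ s) × (∀ u → (∀ i → f i ≤ u) → s ≤ u)

-- 𝐁 is the infinite union of all powers 𝐀 ^ m, m ≥ 0.  As ∪ is the maximum,
-- an infinite union is an entrywise supremum.
IsUnionClosure : ∀ {n} → Matrix n → Matrix n → Set
IsUnionClosure 𝐀 𝐁 = ∀ i j → IsSupremum (λ m → (𝐀 ^ m) i j) (𝐁 i j)

-- The powers below n² do not suffice when n = 1 or n = 2.  In the second
-- example the (0,0) entries of 𝐀 ^ 0, 𝐀 ^ 1, … are L, 𝟎, L, L, A, … (the number
-- of closed walks being 1, 0, 1, 1, 2, …), so 𝐀 ^ 4 is needed.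
insufficient₁ : ¬ ((𝐀 : Matrix 1) → IsUnionClosure 𝐀 (⋃[i< 1 ℕ.^ 2 ] 𝐀))
insufficient₁ h with h (λ _ _ → M) zero zero
... | upper , _ with upper 1
... | s≤s ()

insufficient₂ : ¬ ((𝐀 : Matrix 2) → IsUnionClosure 𝐀 (⋃[i< 2 ℕ.^ 2 ] 𝐀))
insufficient₂ h with h 𝐅 zero zero
  where
  𝐅 : Matrix 2
  𝐅 zero zero = 𝟎
  𝐅 _    _    = L
... | upper , _ with upper 4
... | s≤s ()

{-# OPTIONS --safe #-}
-- An entry of 𝐀 ^ m describes the walks of length m along nonzero entries of 𝐀:
-- it is at least L iff there is a walk, at least M iff some walk uses an M-edge,
-- and at least A iff some walk uses an edge of value at least A or there are two
-- distinct walks.  Cutting loops makes a walk shorter than n, so walks through a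
-- given edge may be taken of length at most 2n − 1.  Two distinct walks of equal
-- length share a walk up to a fork, then run through pairs of distinct vertices,
-- and (after discarding what follows) share a walk again once they have met.  In
-- the middle part loops may be cut in the graph of unordered pairs, which has
-- n(n − 1)/2 vertices, so the total length is less than 2n + n(n − 1)/2, and
-- this is at most n² unless n is 1 or 2.
module Submission where

open import Defs
open import Data.Empty using (⊥-elim)
open import Data.Fin as Fin using (Fin; zero; suc; toℕ; fromℕ<)
import Data.Fin.Properties as Finₚ
open import Data.Nat as ℕ using (ℕ; zero; suc; z≤n; s≤s; z<s; s<s)
import Data.Nat.Properties as ℕₚ
open import Data.Nat.Induction using (<-wellFounded)
open import Data.Nat.Tactic.RingSolver using (solve-∀)
open import Data.Product using (∃; ∃₂; _×_; _,_)
open import Data.Sum using (_⊎_; inj₁; inj₂)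
open import Data.Vec.Functional using (Vector)
open import Function using (_⇔_; mk⇔; _∘_; id)
open import Function.Definitions using (Injective)
open import Induction.WellFounded using (Acc; acc)
open import Relation.Binary.Definitions using (tri<; tri≈; tri>)
open import Relation.Binary.PropositionalEquality using (_≡_; _≢_; refl; sym; cong; subst)
open import Relation.Nullary using (¬_; yes; no; contradiction)

-- Values

rank-injective : Injective _≡_ _≡_ rank
rank-injective {𝟎} {𝟎} _ = refl
rank-injective {L} {L} _ = refl
rank-injective {A} {A} _ = refl
rank-injective {M} {M} _ = refl

rank-∪ : ∀ x y → rank (x ∪ y) ≡ rank x ℕ.⊔ rank y
rank-∪ 𝟎 y = refl
rank-∪ L 𝟎 = refl
rank-∪ L L = refl
rank-∪ L A = refl
rank-∪ L M = refl
rank-∪ A 𝟎 = refl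
rank-∪ A L = refl
rank-∪ A A = refl
rank-∪ A M = refl
rank-∪ M 𝟎 = refl
rank-∪ M L = refl
rank-∪ M A = refl
rank-∪ M M = refl

x≤x∪y : ∀ x y → x ≤ x ∪ y
x≤x∪y x y rewrite rank-∪ x y = ℕₚ.m≤m⊔n (rank x) (rank y)

y≤x∪y : ∀ x y → y ≤ x ∪ y
y≤x∪y x y rewrite rank-∪ x y = ℕₚ.m≤n⊔m (rank x) (rank y)

∪-lub : ∀ x y {u} → x ≤ u → y ≤ u → x ∪ y ≤ u
∪-lub x y rewrite rank-∪ x y = ℕₚ.⊔-lub

≤∪⇒≤⊎≤ : ∀ v x y → v ≤ x ∪ y → v ≤ x ⊎ v ≤ y
≤∪⇒≤⊎≤ v x y v≤ rewrite rank-∪ x y with ℕₚ.⊔-sel (rank x) (rank y)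
... | inj₁ eq = inj₁ (subst (rank v ℕ.≤_) eq v≤)
... | inj₂ eq = inj₂ (subst (rank v ℕ.≤_) eq v≤)

-- The pair `L`, `L` is the only place where sum and maximum differ, so facts about `+` reduce to
-- facts about `∪` and this one case.
+-view : ∀ x y → x + y ≡ x ∪ y ⊎ (x ≡ L × y ≡ L)
+-view 𝟎 y = inj₁ refl
+-view L 𝟎 = inj₁ refl
+-view L L = inj₂ (refl , refl)
+-view L A = inj₁ refl
+-view L M = inj₁ refl
+-view A 𝟎 = inj₁ refl
+-view A L = inj₁ refl
+-view A A = inj₁ refl
+-view A M = inj₁ refl
+-view M 𝟎 = inj₁ refl
+-view M L = inj₁ refl
+-view M A = inj₁ refl
+-view M M = inj₁ refl

x≤x+y : ∀ x y → x ≤ x + y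
x≤x+y x y with +-view x y
... | inj₁ eq rewrite eq = x≤x∪y x y
... | inj₂ (refl , refl) = s≤s z≤n

y≤x+y : ∀ x y → y ≤ x + y
y≤x+y x y with +-view x y
... | inj₁ eq rewrite eq = y≤x∪y x y
... | inj₂ (refl , refl) = s≤s z≤n

L≤⇒A≤+ : ∀ x y → L ≤ x → L ≤ y → A ≤ x + y
L≤⇒A≤+ L L _ _ = ℕₚ.≤-refl
L≤⇒A≤+ L A _ _ = ℕₚ.≤-refl
L≤⇒A≤+ L M _ _ = s≤s (s≤s z≤n)
L≤⇒A≤+ A y _ _ = x≤x+y A y
L≤⇒A≤+ M y _ _ = ℕₚ.≤-trans (s≤s (s≤s z≤n)) (x≤x+y M y)

-- The threshold `A` is excluded because `L + L` reaches it while neither summand does.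
≤+⇒≤⊎≤ : ∀ v x y → v ≢ A → v ≤ x + y → v ≤ x ⊎ v ≤ y
≤+⇒≤⊎≤ v x y v≢A v≤ with +-view x y
... | inj₁ eq = ≤∪⇒≤⊎≤ v x y (subst (v ≤_) eq v≤)
≤+⇒≤⊎≤ 𝟎 _ _ _ _ | inj₂ (refl , refl) = inj₁ z≤n
≤+⇒≤⊎≤ L _ _ _ _ | inj₂ (refl , refl) = inj₁ ℕₚ.≤-refl
≤+⇒≤⊎≤ A _ _ v≢A _ | inj₂ (refl , refl) = contradiction refl v≢A
≤+⇒≤⊎≤ M _ _ _ (s≤s (s≤s ())) | inj₂ (refl , refl)

A≤+⇒ : ∀ x y → A ≤ x + y → (A ≤ x ⊎ A ≤ y) ⊎ (L ≤ x × L ≤ y)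
A≤+⇒ x y A≤ with +-view x y
... | inj₁ eq            = inj₁ (≤∪⇒≤⊎≤ A x y (subst (A ≤_) eq A≤))
... | inj₂ (refl , refl) = inj₂ (ℕₚ.≤-refl , ℕₚ.≤-refl)

·-nonzero : ∀ x y → L ≤ x → L ≤ y → x · y ≡ x ∪ y
·-nonzero L L _ _ = refl
·-nonzero L A _ _ = refl
·-nonzero L M _ _ = refl
·-nonzero A L _ _ = refl
·-nonzero A A _ _ = refl
·-nonzero A M _ _ = refl
·-nonzero M L _ _ = refl
·-nonzero M A _ _ = refl
·-nonzero M M _ _ = refl

L≤·⇒L≤×L≤ : ∀ x y → L ≤ x · y → L ≤ x × L ≤ y
L≤·⇒L≤×L≤ L L _ = s≤s z≤n , s≤s z≤n
L≤·⇒L≤×L≤ L A _ = s≤s z≤n , s≤s z≤n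
L≤·⇒L≤×L≤ L M _ = s≤s z≤n , s≤s z≤n
L≤·⇒L≤×L≤ A L _ = s≤s z≤n , s≤s z≤n
L≤·⇒L≤×L≤ A A _ = s≤s z≤n , s≤s z≤n
L≤·⇒L≤×L≤ A M _ = s≤s z≤n , s≤s z≤n
L≤·⇒L≤×L≤ M L _ = s≤s z≤n , s≤s z≤n
L≤·⇒L≤×L≤ M A _ = s≤s z≤n , s≤s z≤n
L≤·⇒L≤×L≤ M M _ = s≤s z≤n , s≤s z≤n

≤·⇒≤⊎≤ : ∀ v x y → L ≤ x → L ≤ y → v ≤ x · y → v ≤ x ⊎ v ≤ y
≤·⇒≤⊎≤ v x y L≤x L≤y v≤ = ≤∪⇒≤⊎≤ v x y (subst (v ≤_) (·-nonzero x y L≤x L≤y) v≤)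

x≤x·y : ∀ x y → L ≤ y → x ≤ x · y
x≤x·y 𝟎 y L≤y = z≤n
x≤x·y x@L y L≤y rewrite ·-nonzero x y (s≤s z≤n) L≤y = x≤x∪y x y
x≤x·y x@A y L≤y rewrite ·-nonzero x y (s≤s z≤n) L≤y = x≤x∪y x y
x≤x·y x@M y L≤y rewrite ·-nonzero x y (s≤s z≤n) L≤y = x≤x∪y x y

y≤x·y : ∀ x y → L ≤ x → y ≤ x · y
y≤x·y x 𝟎 L≤x = z≤n
y≤x·y x y@L L≤x rewrite ·-nonzero x y L≤x (s≤s z≤n) = y≤x∪y x y
y≤x·y x y@A L≤x rewrite ·-nonzero x y L≤x (s≤s z≤n) = y≤x∪y x y
y≤x·y x y@M L≤x rewrite ·-nonzero x y L≤x (s≤s z≤n) = y≤x∪y x y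

-- Sums

≤∑ : ∀ {n} (f : Vector Value n) k → f k ≤ ∑ f
≤∑ f zero    = x≤x+y (f zero) (∑ (f ∘ suc))
≤∑ f (suc k) = ℕₚ.≤-trans (≤∑ (f ∘ suc) k) (y≤x+y (f zero) (∑ (f ∘ suc)))

-- Two nonzero terms already contribute at least `L + L`. Ordering the indices lets the induction
-- stop at the smaller one.
A≤∑ : ∀ {n} (f : Vector Value n) {k k′} → k Fin.< k′ → L ≤ f k → L ≤ f k′ → A ≤ ∑ f
A≤∑ f {zero}  {suc k′} _         L≤k L≤k′ =
  L≤⇒A≤+ (f zero) (∑ (f ∘ suc)) L≤k (ℕₚ.≤-trans L≤k′ (≤∑ (f ∘ suc) k′))
A≤∑ f {suc k} {suc k′} (s<s k<k′) L≤k L≤k′ =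
  ℕₚ.≤-trans (A≤∑ (f ∘ suc) k<k′ L≤k L≤k′) (y≤x+y (f zero) (∑ (f ∘ suc)))

≤∑⇒∃ : ∀ {n} v → L ≤ v → v ≢ A → (f : Vector Value n) → v ≤ ∑ f → ∃ λ k → v ≤ f k
≤∑⇒∃ {zero}  v L≤v _ f v≤ with ℕₚ.≤-trans L≤v v≤
... | ()
≤∑⇒∃ {suc n} v L≤v v≢A f v≤ with ≤+⇒≤⊎≤ v (f zero) (∑ (f ∘ suc)) v≢A v≤
... | inj₁ v≤f0 = zero , v≤f0
... | inj₂ v≤∑  = let k , v≤fk = ≤∑⇒∃ v L≤v v≢A (f ∘ suc) v≤∑ in suc k , v≤fk

A≤∑⇒∃ : ∀ {n} (f : Vector Value n) → A ≤ ∑ f →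
        (∃ λ k → A ≤ f k) ⊎ (∃₂ λ k k′ → k Fin.< k′ × L ≤ f k × L ≤ f k′)
A≤∑⇒∃ {suc n} f A≤ with A≤+⇒ (f zero) (∑ (f ∘ suc)) A≤
... | inj₁ (inj₁ A≤f0) = inj₁ (zero , A≤f0)
... | inj₂ (L≤f0 , L≤∑) =
  let k , L≤fk = ≤∑⇒∃ L ℕₚ.≤-refl (λ ()) (f ∘ suc) L≤∑
  in inj₂ (zero , suc k , z<s , L≤f0 , L≤fk)
... | inj₁ (inj₂ A≤∑) with A≤∑⇒∃ (f ∘ suc) A≤∑
...   | inj₁ (k , A≤fk)                   = inj₁ (suc k , A≤fk)
...   | inj₂ (k , k′ , k<k′ , L≤k , L≤k′) = inj₂ (suc k , suc k′ , s<s k<k′ , L≤k , L≤k′)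

-- Walks

infixr 5 _∷_

data Walk {S : Set} (R : S → S → Set) : ℕ → S → S → Set where
  []  : ∀ {s} → Walk R 0 s s
  _∷_ : ∀ {m s t u} → R s t → Walk R m t u → Walk R (suc m) s u

module _ {S : Set} {R : S → S → Set} where

  vertex : ∀ {m s t} → Walk R m s t → Fin (suc m) → S
  vertex {s = s} _       zero    = s
  vertex         (_ ∷ w) (suc i) = vertex w i

  takeWalk : ∀ {m s t} (w : Walk R m s t) i → Walk R (toℕ i) s (vertex w i)
  takeWalk w       zero    = []
  takeWalk (e ∷ w) (suc i) = e ∷ takeWalk w i

  dropWalk : ∀ {m s t} (w : Walk R m s t) i → Walk R (m ℕ.∸ toℕ i) (vertex w i) t
  dropWalk w       zero    = w
  dropWalk (_ ∷ w) (suc i) = dropWalk w i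

  infixr 5 _++_

  _++_ : ∀ {l m s t u} → Walk R l s t → Walk R m t u → Walk R (l ℕ.+ m) s u
  []      ++ w′ = w′
  (e ∷ w) ++ w′ = e ∷ (w ++ w′)

  -- The injection `code` bounds the number of vertices by `K`. A longer walk repeats a vertex, and
  -- removing the stretch between the two visits strictly decreases the length, hence the
  -- well-founded recursion.
  shorten : ∀ {K} (code : S → Fin K) → Injective _≡_ _≡_ code →
            ∀ {m s t} → Walk R m s t → ∃ λ l → l ℕ.< K × Walk R l s t
  shorten {K} code code-injective {m} = go (<-wellFounded m)
    where
    go : ∀ {m s t} → Acc ℕ._<_ m → Walk R m s t → ∃ λ l → l ℕ.< K × Walk R l s t
    go {m} {s} {t} (acc rec) w with m ℕₚ.<? K
    ... | yes m<K = m , m<K , w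
    -- A walk of length `m` has `m + 1` vertices, so `K ≤ m` already forces a repetition.
    ... | no  m≮K with Finₚ.pigeonhole (s≤s (ℕₚ.≮⇒≥ m≮K)) (code ∘ vertex w)
    ...   | i , j , i<j , eq = go (rec shorter) (takeWalk w i ++ rest)
      where
      rest : Walk R (m ℕ.∸ toℕ j) (vertex w i) t
      rest = subst (λ v → Walk R _ v t) (sym (code-injective eq)) (dropWalk w j)

      shorter : toℕ i ℕ.+ (m ℕ.∸ toℕ j) ℕ.< m
      shorter = ℕₚ.<-≤-trans (ℕₚ.+-monoˡ-< (m ℕ.∸ toℕ j) i<j)
        (ℕₚ.≤-reflexive (ℕₚ.m+[n∸m]≡n (Finₚ.toℕ≤pred[n] j)))

-- Unordered pairs

-- This is n(n - 1)/2, the number of unordered pairs of distinct elements of `Fin n`.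
triangle : ℕ → ℕ
triangle zero    = 0
triangle (suc n) = triangle n ℕ.+ n

triangle-mono-≤ : ∀ {m n} → m ℕ.≤ n → triangle m ℕ.≤ triangle n
triangle-mono-≤ z≤n       = z≤n
triangle-mono-≤ (s≤s m≤n) = ℕₚ.+-mono-≤ (triangle-mono-≤ m≤n) m≤n

-- Codes of pairs with larger element `q` fill the block from `triangle q` up to, but excluding,
-- `triangle (suc q)`; blocks of different `q` are disjoint.
triangle-separates : ∀ {p q p′ q′} → p ℕ.< q → q ℕ.< q′ →
                     triangle q ℕ.+ p ℕ.< triangle q′ ℕ.+ p′
triangle-separates {p} {q} {p′} {q′} p<q q<q′ = begin-strict
  triangle q ℕ.+ p    <⟨ ℕₚ.+-monoʳ-< (triangle q) p<q ⟩
  triangle (suc q)    ≤⟨ triangle-mono-≤ q<q′ ⟩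
  triangle q′         ≤⟨ ℕₚ.m≤m+n (triangle q′) p′ ⟩
  triangle q′ ℕ.+ p′  ∎
  where open ℕₚ.≤-Reasoning

-- Storing the smaller element first gives every unordered pair a single representative.
record Pair (n : ℕ) : Set where
  constructor pair
  field
    lo hi : Fin n
    lo<hi : lo Fin.< hi

open Pair

pairCode< : ∀ {n} (s : Pair n) → triangle (toℕ (hi s)) ℕ.+ toℕ (lo s) ℕ.< triangle n
pairCode< (pair p q p<q) = ℕₚ.<-≤-trans
  (ℕₚ.+-monoʳ-< (triangle (toℕ q)) p<q) (triangle-mono-≤ (Finₚ.toℕ<n q))

pairCode : ∀ {n} → Pair n → Fin (triangle n)
pairCode s = fromℕ< (pairCode< s)

pairCode-injective : ∀ {n} → Injective _≡_ _≡_ (pairCode {n})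
pairCode-injective {n} {s@(pair p q p<q)} {t@(pair p′ q′ p′<q′)} eq
  with Finₚ.fromℕ<-injective _ _ (pairCode< s) (pairCode< t) eq | Finₚ.<-cmp q q′
... | eq′ | tri< q<q′ _ _ = ⊥-elim (ℕₚ.<⇒≢ (triangle-separates p<q q<q′) eq′)
... | eq′ | tri> _ _ q′<q = ⊥-elim (ℕₚ.<⇒≢ (triangle-separates p′<q′ q′<q) (sym eq′))
... | eq′ | tri≈ _ refl _
  with Finₚ.toℕ-injective (ℕₚ.+-cancelˡ-≡ (triangle (toℕ q)) _ _ eq′)
...   | refl = cong (pair p q) (ℕₚ.<-irrelevant p<q p′<q′)

-- Equality holds at `n = 3`; from `n` to `n + 1` the left side grows by `n + 2` and the right side
-- by `2n + 1`.
2n+triangle≤n² : ∀ n → n ≢ 1 → n ≢ 2 → n ℕ.+ (triangle n ℕ.+ n) ℕ.≤ n ℕ.^ 2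
2n+triangle≤n² 0 _ _ = z≤n
2n+triangle≤n² 1 n≢1 _ = contradiction refl n≢1
2n+triangle≤n² 2 _ n≢2 = contradiction refl n≢2
2n+triangle≤n² 3 _ _ = ℕₚ.≤-refl
2n+triangle≤n² (suc n@(suc (suc (suc k)))) _ _ = begin
  suc n ℕ.+ (triangle n ℕ.+ n ℕ.+ suc n)        ≡⟨ regroup n (triangle n) ⟩
  n ℕ.+ (triangle n ℕ.+ n) ℕ.+ (2 ℕ.+ n)        ≤⟨ ℕₚ.+-mono-≤ (2n+triangle≤n² n (λ ()) (λ ())) 2+n≤1+n+n ⟩
  n ℕ.^ 2 ℕ.+ (1 ℕ.+ (n ℕ.+ n))                 ≡⟨ square n ⟩
  suc n ℕ.^ 2                                   ∎
  where
  open ℕₚ.≤-Reasoning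
  regroup : ∀ n t → suc n ℕ.+ (t ℕ.+ n ℕ.+ suc n) ≡ n ℕ.+ (t ℕ.+ n) ℕ.+ (2 ℕ.+ n)
  regroup = solve-∀
  square : ∀ n → n ℕ.* (n ℕ.* 1) ℕ.+ (1 ℕ.+ (n ℕ.+ n)) ≡ suc n ℕ.* (suc n ℕ.* 1)
  square = solve-∀
  2+n≤1+n+n : 2 ℕ.+ n ℕ.≤ 1 ℕ.+ (n ℕ.+ n)
  2+n≤1+n+n = s≤s (ℕₚ.+-monoˡ-≤ n {1} {n} (s≤s z≤n))

-- Walks and matrix powers

L≤𝐈 : ∀ {n} (i : Fin n) → L ≤ 𝐈 i i
L≤𝐈 i with i Finₚ.≟ i
... | yes _  = ℕₚ.≤-refl
... | no i≢i = contradiction refl i≢i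

L≤𝐈⇒≡ : ∀ {n} (i j : Fin n) → L ≤ 𝐈 i j → i ≡ j
L≤𝐈⇒≡ i j L≤ with i Finₚ.≟ j
L≤𝐈⇒≡ i j L≤ | yes eq = eq
L≤𝐈⇒≡ i j () | no _

A≰𝐈 : ∀ {n} (i j : Fin n) → ¬ A ≤ 𝐈 i j
A≰𝐈 i j A≤ with i Finₚ.≟ j
A≰𝐈 i j (s≤s ()) | yes _
A≰𝐈 i j ()       | no _

module _ {n : ℕ} (𝐀 : Matrix n) where

  Edge : Fin n → Fin n → Set
  Edge i j = L ≤ 𝐀 i j

  -- Two walkers move simultaneously; the second alternative covers a step that reverses their
  -- order.
  PairEdge : Pair n → Pair n → Set
  PairEdge s t = (Edge (lo s) (lo t) × Edge (hi s) (hi t)) ⊎ (Edge (lo s) (hi t) × Edge (hi s) (lo t))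

  edge-power : ∀ v {i k j m} → v ≤ 𝐀 i k → L ≤ (𝐀 ^ m) k j → v ≤ (𝐀 ^ suc m) i j
  edge-power v {i} {k} {j} {m} v≤ L≤ = ℕₚ.≤-trans v≤
    (ℕₚ.≤-trans (x≤x·y (𝐀 i k) ((𝐀 ^ m) k j) L≤) (≤∑ (λ k → 𝐀 i k · (𝐀 ^ m) k j) k))

  ∷-power : ∀ v {i k j m} → Edge i k → v ≤ (𝐀 ^ m) k j → v ≤ (𝐀 ^ suc m) i j
  ∷-power v {i} {k} {j} {m} L≤ v≤ = ℕₚ.≤-trans v≤
    (ℕₚ.≤-trans (y≤x·y (𝐀 i k) ((𝐀 ^ m) k j) L≤) (≤∑ (λ k → 𝐀 i k · (𝐀 ^ m) k j) k))

  ++-power : ∀ v {i k j l m} → Walk Edge l i k → v ≤ (𝐀 ^ m) k j → v ≤ (𝐀 ^ (l ℕ.+ m)) i j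
  ++-power v []      v≤ = v≤
  ++-power v {l = suc l} {m} (e ∷ w) v≤ = ∷-power v {m = l ℕ.+ m} e (++-power v {m = m} w v≤)

  walk⇒L≤power : ∀ {m i j} → Walk Edge m i j → L ≤ (𝐀 ^ m) i j
  walk⇒L≤power {j = j} []      = L≤𝐈 j
  walk⇒L≤power {suc m} (e ∷ w) = ∷-power L {m = m} e (walk⇒L≤power w)

  pairWalk-power : ∀ {l m s t j} → Walk PairEdge l s t →
    L ≤ (𝐀 ^ m) (lo t) j × L ≤ (𝐀 ^ m) (hi t) j →
    L ≤ (𝐀 ^ (l ℕ.+ m)) (lo s) j × L ≤ (𝐀 ^ (l ℕ.+ m)) (hi s) j
  pairWalk-power []      L≤ = L≤
  pairWalk-power {suc l} {m} (e ∷ w) L≤ with e | pairWalk-power {m = m} w L≤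
  ... | inj₁ (e₁ , e₂) | L≤lo , L≤hi =
    ∷-power L {m = l ℕ.+ m} e₁ L≤lo , ∷-power L {m = l ℕ.+ m} e₂ L≤hi
  ... | inj₂ (e₁ , e₂) | L≤lo , L≤hi =
    ∷-power L {m = l ℕ.+ m} e₁ L≤hi , ∷-power L {m = l ℕ.+ m} e₂ L≤lo

  -- The summands at `lo s` and `hi s` are both nonzero and have different indices.
  fork-power : ∀ {i j m} (s : Pair n) → Edge i (lo s) → Edge i (hi s) →
    L ≤ (𝐀 ^ m) (lo s) j × L ≤ (𝐀 ^ m) (hi s) j → A ≤ (𝐀 ^ suc m) i j
  fork-power {i} {j} {m} (pair p q p<q) e₁ e₂ (L≤p , L≤q) = A≤∑ (λ k → 𝐀 i k · (𝐀 ^ m) k j) p<q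
    (ℕₚ.≤-trans L≤p (y≤x·y (𝐀 i p) ((𝐀 ^ m) p j) e₁))
    (ℕₚ.≤-trans L≤q (y≤x·y (𝐀 i q) ((𝐀 ^ m) q j) e₂))

  L≤power⇒walk : ∀ m {i j} → L ≤ (𝐀 ^ m) i j → Walk Edge m i j
  L≤power⇒walk zero {i} {j} L≤ with L≤𝐈⇒≡ i j L≤
  ... | refl = []
  L≤power⇒walk (suc m) {i} {j} L≤ =
    let k , L≤k = ≤∑⇒∃ L ℕₚ.≤-refl (λ ()) (λ k → 𝐀 i k · (𝐀 ^ m) k j) L≤
        e , L≤m = L≤·⇒L≤×L≤ (𝐀 i k) ((𝐀 ^ m) k j) L≤k
    in e ∷ L≤power⇒walk m L≤m

  -- Walk patterns behind large entries

  record Via (v : Value) (i j : Fin n) : Set where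
    constructor via
    field
      {a b}     : Fin n
      {l₁ l₂}   : ℕ
      before    : Walk Edge l₁ i a
      edge      : v ≤ 𝐀 a b
      after     : Walk Edge l₂ b j

  record Meeting (s : Pair n) (j : Fin n) : Set where
    constructor meeting
    field
      {t}     : Pair n
      {r}     : Fin n
      {l₁ l₂} : ℕ
      apart   : Walk PairEdge l₁ s t
      edge₁   : Edge (lo t) r
      edge₂   : Edge (hi t) r
      joint   : Walk Edge l₂ r j

  record Fork (i j : Fin n) : Set where
    constructor fork
    field
      {p}    : Fin n
      {s}    : Pair n
      {l}    : ℕ
      before : Walk Edge l i p
      edge₁  : Edge p (lo s)
      edge₂  : Edge p (hi s)
      meet   : Meeting s j

  ∷-via : ∀ {v i k j} → Edge i k → Via v k j → Via v i j
  ∷-via e (via w e′ w′) = via (e ∷ w) e′ w′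

  ∷-fork : ∀ {i k j} → Edge i k → Fork k j → Fork i j
  ∷-fork e (fork w e₁ e₂ mt) = fork (e ∷ w) e₁ e₂ mt

  ∷-meeting : ∀ {s t j} → PairEdge s t → Meeting t j → Meeting s j
  ∷-meeting e (meeting w e₁ e₂ w′) = meeting (e ∷ w) e₁ e₂ w′

  -- Followed in lockstep, walks with different starts and a common end must coincide at some time.
  -- At the first such time the rest of the second walk is dropped, and the rest of the first serves
  -- both.
  walks⇒meeting : ∀ {m p q j} (p<q : p Fin.< q) →
    Walk Edge m p j → Walk Edge m q j → Meeting (pair p q p<q) j
  walks⇒meeting p<q [] [] = ⊥-elim (ℕₚ.<-irrefl refl p<q)
  walks⇒meeting p<q (_∷_ {t = p′} e₁ w₁) (_∷_ {t = q′} e₂ w₂) with Finₚ.<-cmp p′ q′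
  ... | tri< p′<q′ _ _ = ∷-meeting (inj₁ (e₁ , e₂)) (walks⇒meeting p′<q′ w₁ w₂)
  ... | tri≈ _ refl _  = meeting [] e₁ e₂ w₁
  ... | tri> _ _ q′<p′ = ∷-meeting (inj₂ (e₁ , e₂)) (walks⇒meeting q′<p′ w₂ w₁)

  ≤·⇒via : ∀ v m {i k j} → L ≤ v → v ≤ 𝐀 i k · (𝐀 ^ m) k j →
           Via v i j ⊎ (Edge i k × v ≤ (𝐀 ^ m) k j)
  ≤·⇒via v m {i} {k} {j} L≤v v≤
    with L≤·⇒L≤×L≤ (𝐀 i k) ((𝐀 ^ m) k j) (ℕₚ.≤-trans L≤v v≤)
  ... | e , L≤m with ≤·⇒≤⊎≤ v (𝐀 i k) ((𝐀 ^ m) k j) e L≤m v≤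
  ...   | inj₁ v≤𝐀 = inj₁ (via [] v≤𝐀 (L≤power⇒walk m L≤m))
  ...   | inj₂ v≤m = inj₂ (e , v≤m)

  M≤power⇒via : ∀ m {i j} → M ≤ (𝐀 ^ m) i j → Via M i j
  M≤power⇒via zero {i} {j} M≤ = ⊥-elim (A≰𝐈 i j (ℕₚ.≤-trans (s≤s (s≤s z≤n)) M≤))
  M≤power⇒via (suc m) {i} {j} M≤
    with ≤∑⇒∃ M (s≤s z≤n) (λ ()) (λ k → 𝐀 i k · (𝐀 ^ m) k j) M≤
  ... | k , M≤k with ≤·⇒via M m (s≤s z≤n) M≤k
  ...   | inj₁ h         = h
  ...   | inj₂ (e , M≤m) = ∷-via e (M≤power⇒via m M≤m)

  -- First edges are peeled off one by one. A sum reaches `A` through a single term, which leads to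
  -- an edge or to the recursion, or through two nonzero terms, which are the fork. The identity
  -- matrix has no entry above `L`.
  A≤power⇒via⊎fork : ∀ m {i j} → A ≤ (𝐀 ^ m) i j → Via A i j ⊎ Fork i j
  A≤power⇒via⊎fork zero {i} {j} A≤ = ⊥-elim (A≰𝐈 i j A≤)
  A≤power⇒via⊎fork (suc m) {i} {j} A≤ with A≤∑⇒∃ (λ k → 𝐀 i k · (𝐀 ^ m) k j) A≤
  ... | inj₂ (k , k′ , k<k′ , L≤k , L≤k′) =
    let e₁ , L≤₁ = L≤·⇒L≤×L≤ (𝐀 i k) ((𝐀 ^ m) k j) L≤k
        e₂ , L≤₂ = L≤·⇒L≤×L≤ (𝐀 i k′) ((𝐀 ^ m) k′ j) L≤k′
    in inj₂ (fork [] e₁ e₂ (walks⇒meeting k<k′ (L≤power⇒walk m L≤₁) (L≤power⇒walk m L≤₂)))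
  ... | inj₁ (k , A≤k) with ≤·⇒via A m (s≤s z≤n) A≤k
  ...   | inj₁ h = inj₁ h
  ...   | inj₂ (e , A≤m) with A≤power⇒via⊎fork m A≤m
  ...     | inj₁ h = inj₁ (∷-via e h)
  ...     | inj₂ f = inj₂ (∷-fork e f)

  -- Short witnesses

  Early : ℕ → Value → Fin n → Fin n → Set
  Early b v i j = ∃ λ m → m ℕ.< b × v ≤ (𝐀 ^ m) i j

  early-mono : ∀ {b b′} v {i j} → b ℕ.≤ b′ → Early b v i j → Early b′ v i j
  early-mono _ b≤b′ (m , m<b , v≤) = m , ℕₚ.<-≤-trans m<b b≤b′ , v≤

  walk⇒early : ∀ {m i j} → Walk Edge m i j → Early n L i j
  walk⇒early w = let l , l<n , w′ = shorten id id w in l , l<n , walk⇒L≤power w′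

  via⇒early : ∀ v {i j} → Via v i j → Early (n ℕ.+ n) v i j
  via⇒early v (via w e w′) =
    let l₁ , l₁<n , u₁ = shorten id id w
        l₂ , l₂<n , L≤ = walk⇒early w′
    -- The two strict bounds leave two units: one for the edge, one to keep the total below `n + n`.
    in l₁ ℕ.+ suc l₂ , ℕₚ.+-mono-≤ l₁<n l₂<n
     , ++-power v {m = suc l₂} u₁ (edge-power v {m = l₂} e L≤)

  -- Shortening the middle part in the graph of pairs keeps its end pairs, so the walks still fork
  -- into `s` and can still meet. Three strict bounds leave room for the forking step, the meeting
  -- step and the final strictness.
  fork⇒early : ∀ {i j} → Fork i j → Early (n ℕ.+ (triangle n ℕ.+ n)) A i j
  fork⇒early (fork {s = s} w e₁ e₂ (meeting wp e₁′ e₂′ w′)) =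
    let l₁ , l₁<n , u₁ = shorten id id w
        l₂ , l₂<T , u₂ = shorten pairCode pairCode-injective wp
        l₃ , l₃<n , L≤ = walk⇒early w′
        L≤L≤ = pairWalk-power {m = suc l₃} u₂ (∷-power L {m = l₃} e₁′ L≤ , ∷-power L {m = l₃} e₂′ L≤)
        m = l₂ ℕ.+ suc l₃
    in l₁ ℕ.+ suc m , ℕₚ.+-mono-≤ l₁<n (ℕₚ.+-mono-≤ l₂<T l₃<n)
     , ++-power A {m = suc m} u₁ (fork-power {m = m} s e₁ e₂ L≤L≤)

  ≤power⇒early : ∀ v m {i j} → v ≤ (𝐀 ^ m) i j → Early (n ℕ.+ (triangle n ℕ.+ n)) v i j
  ≤power⇒early 𝟎 m {i} _ =
    -- Power zero is in range because `i : Fin n` makes `n` positive.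
    0 , ℕₚ.<-≤-trans (ℕₚ.≤-<-trans z≤n (Finₚ.toℕ<n i)) (ℕₚ.m≤m+n n _) , z≤n
  ≤power⇒early L m L≤ =
    early-mono L (ℕₚ.m≤m+n n _) (walk⇒early (L≤power⇒walk m L≤))
  ≤power⇒early A m A≤ with A≤power⇒via⊎fork m A≤
  ... | inj₁ h = early-mono A (ℕₚ.+-monoʳ-≤ n (ℕₚ.m≤n+m n _)) (via⇒early A h)
  ... | inj₂ f = fork⇒early f
  ≤power⇒early M m M≤ =
    early-mono M (ℕₚ.+-monoʳ-≤ n (ℕₚ.m≤n+m n _)) (via⇒early M (M≤power⇒via m M≤))

  -- Finite unions and the closure

  power≤⋃ : ∀ b {m i j} → m ℕ.< b → (𝐀 ^ m) i j ≤ (⋃[i< b ] 𝐀) i j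
  power≤⋃ (suc b) {m} {i} {j} (s≤s m≤b) with ℕₚ.m≤n⇒m<n∨m≡n m≤b
  ... | inj₁ m<b  = ℕₚ.≤-trans (power≤⋃ b m<b) (x≤x∪y ((⋃[i< b ] 𝐀) i j) ((𝐀 ^ b) i j))
  ... | inj₂ refl = y≤x∪y ((⋃[i< b ] 𝐀) i j) ((𝐀 ^ b) i j)

  ⋃-least : ∀ b {i j u} → (∀ m → (𝐀 ^ m) i j ≤ u) → (⋃[i< b ] 𝐀) i j ≤ u
  ⋃-least zero _ = z≤n
  ⋃-least (suc b) {i} {j} {u} ≤u = ∪-lub ((⋃[i< b ] 𝐀) i j) ((𝐀 ^ b) i j) {u} (⋃-least b {u = u} ≤u) (≤u b)

  ⋃-isUnionClosure : n ≢ 1 → n ≢ 2 → IsUnionClosure 𝐀 (⋃[i< n ℕ.^ 2 ] 𝐀)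
  ⋃-isUnionClosure n≢1 n≢2 i j = upper , λ u → ⋃-least (n ℕ.^ 2) {u = u}
    where
    upper : ∀ m → (𝐀 ^ m) i j ≤ (⋃[i< n ℕ.^ 2 ] 𝐀) i j
    upper m =
      -- The entry itself is taken as the threshold, so an early power dominates it.
      let l , l<b , v≤ = ≤power⇒early ((𝐀 ^ m) i j) m ℕₚ.≤-refl
      in ℕₚ.≤-trans v≤ (power≤⋃ (n ℕ.^ 2) (ℕₚ.<-≤-trans l<b (2n+triangle≤n² n n≢1 n≢2)))

IsSupremum-unique : ∀ {I : Set} (f : I → Value) {s t} → IsSupremum f s → IsSupremum f t → s ≡ t
IsSupremum-unique f {s} {t} (s-ub , s-least) (t-ub , t-least) =
  rank-injective (ℕₚ.≤-antisym (s-least t t-ub) (t-least s s-ub))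

theorem20 : (n : ℕ) → n ≢ 1 → n ≢ 2 → (𝐀 𝐁 : Matrix n) →
    IsUnionClosure 𝐀 𝐁 ⇔ 𝐁 ≐ ⋃[i< n ℕ.^ 2 ] 𝐀
theorem20 n n≢1 n≢2 𝐀 𝐁 = mk⇔
  -- Both matrices are entrywise suprema of the same family of powers.
  (λ closure i j → IsSupremum-unique (λ m → (𝐀 ^ m) i j) (closure i j) (⋃-closure i j))
  (λ 𝐁≐⋃ i j → subst (IsSupremum (λ m → (𝐀 ^ m) i j)) (sym (𝐁≐⋃ i j)) (⋃-closure i j))
  where
  ⋃-closure : IsUnionClosure 𝐀 (⋃[i< n ℕ.^ 2 ] 𝐀)
  ⋃-closure = ⋃-isUnionClosure 𝐀 n≢1 n≢2
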